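{- Let $G$ be a strongly connected $k$-out graph. If $|\operatorname{Aut}(G)|$ is divisible by a prime $p>k$, then $G$ is not totally synchronizing.
   Context: A graph is a finite directed multigraph $G=(V,E,s,t)$ with source and target maps $s,t:E\to V$ (loops and parallel edges allowed). It is $k$-out if every vertex has exactly $k$ outgoing edges. An automorphism of $G$ is a pair $\varphi=(\varphi_v,\varphi_e)$ of bijections $V\to V$, $E\to E$ with $s\varphi_e=\varphi_v s$ and $t\varphi_e=\varphi_v t$; $\operatorname{Aut}(G)$ is the group of automorphisms (automorphisms fixing all vertices but permuting parallel edges are counted as nontrivial elements). A coloring of $G$ is a map $\chi:E\to[k]=\{1,\dots,k\}$ whose restriction to the set of outgoing edges of each vertex is a bijection onto $[k]$. It defines the deterministic complete automaton $\chi(G)=(V,[k],\delta_\chi)$, where $\delta_\chi(v,a)=t(e)$ for the unique edge $e$ with $s(e)=v$, $\chi(e)=a$. The automaton is synchronizing if there is a word $w\in[k]^*$ with $|V\cdot w|=1$. $G$ is totally synchronizing if $\chi(G)$ is synchronizing for every coloring $\chi$ of $G$. -}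

module Defs where

open import Algebra.Bundles using (Group)
open import Data.Fin.Base using (Fin)
open import Data.Fin.Permutation
  using (Permutation′; _⟨$⟩ʳ_; _⟨$⟩ˡ_; _∘ₚ_; inverseˡ; inverseʳ)
  renaming (_≈_ to _≈ₚ_; id to idₚ; flip to flipₚ)
open import Data.Fin.Properties using (_≟_; any?)
open import Data.Fin.Subset using (Subset; ∣_∣)
open import Data.List.Base using (List; foldl)
open import Data.Nat.Base using (ℕ)
open import Data.Product.Base using (Σ-syntax; ∃-syntax; _×_; _,_; proj₁; proj₂)
open import Data.Vec.Base using (tabulate)
open import Function.Bundles using (Bijection)
open import Function.Definitions using (Bijective)
open import Level using (Level; 0ℓ)
open import Relation.Binary.Bundles using (Setoid)
open import Relation.Binary.Construct.Closure.ReflexiveTransitive using (Star)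
open import Relation.Binary.PropositionalEquality
  using (_≡_; refl; sym; trans; cong; setoid)
open import Relation.Nullary.Decidable using (does)

private
  variable
    a ℓ : Level

HasCardinality : Setoid a ℓ → ℕ → Set _
HasCardinality S n = Bijection S (setoid (Fin n))

record Graph : Set where
  field
    #V #E  : ℕ
    source : Fin #E → Fin #V
    target : Fin #E → Fin #V

  V E : Set
  V = Fin #V
  E = Fin #E

  -- Equality on V is decidable, so the proof component is unique and
  -- propositional equality on Out v is equality of edges.
  Out : V → Set
  Out v = Σ[ e ∈ E ] source e ≡ v

  Arc : V → V → Set
  Arc u v = ∃[ e ] (source e ≡ u × target e ≡ v)

  IsKOut : ℕ → Set
  IsKOut k = ∀ v → HasCardinality (setoid (Out v)) k

  StronglyConnected : Set
  StronglyConnected = ∀ u v → Star Arc u v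

------------------------------------------------------------------------
-- The automorphism group

module _ (G : Graph) where
  open Graph G

  record Automorphism : Set where
    field
      φᵥ : Permutation′ #V
      φₑ : Permutation′ #E
      source-commutes : ∀ e → source (φₑ ⟨$⟩ʳ e) ≡ φᵥ ⟨$⟩ʳ source e
      target-commutes : ∀ e → target (φₑ ⟨$⟩ʳ e) ≡ φᵥ ⟨$⟩ʳ target e

  open Automorphism

  -- Equality of the underlying maps on vertices and on edges; in
  -- particular, nontrivially permuting parallel edges is not the identity.
  _≈ᴬ_ : Automorphism → Automorphism → Set
  φ ≈ᴬ ψ = φᵥ φ ≈ₚ φᵥ ψ × φₑ φ ≈ₚ φₑ ψ

  idᴬ : Automorphism
  idᴬ = record
    { φᵥ = idₚ
    ; φₑ = idₚ
    ; source-commutes = λ _ → refl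
    ; target-commutes = λ _ → refl
    }

  -- (φ ∘ᴬ ψ) applies ψ first, whereas _∘ₚ_ is in diagrammatic order.
  _∘ᴬ_ : Automorphism → Automorphism → Automorphism
  φ ∘ᴬ ψ = record
    { φᵥ = φᵥ ψ ∘ₚ φᵥ φ
    ; φₑ = φₑ ψ ∘ₚ φₑ φ
    ; source-commutes = λ e → trans (source-commutes φ (φₑ ψ ⟨$⟩ʳ e))
                                    (cong (φᵥ φ ⟨$⟩ʳ_) (source-commutes ψ e))
    ; target-commutes = λ e → trans (target-commutes φ (φₑ ψ ⟨$⟩ʳ e))
                                    (cong (φᵥ φ ⟨$⟩ʳ_) (target-commutes ψ e))
    }

  private
    inv-commutes : (π : Permutation′ #V) (ρ : Permutation′ #E) (f : E → V) →
                   (∀ e → f (ρ ⟨$⟩ʳ e) ≡ π ⟨$⟩ʳ f e) →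
                   ∀ e → f (ρ ⟨$⟩ˡ e) ≡ π ⟨$⟩ˡ f e
    inv-commutes π ρ f comm e =
      trans (sym (inverseˡ π))
            (cong (π ⟨$⟩ˡ_) (trans (sym (comm (ρ ⟨$⟩ˡ e))) (cong f (inverseʳ ρ))))

    ⟨$⟩ˡ-cong : ∀ {n} (π ρ : Permutation′ n) → π ≈ₚ ρ → flipₚ π ≈ₚ flipₚ ρ
    ⟨$⟩ˡ-cong π ρ π≈ρ i =
      trans (sym (inverseˡ ρ))
            (cong (ρ ⟨$⟩ˡ_) (trans (sym (π≈ρ (π ⟨$⟩ˡ i))) (inverseʳ π)))

  _⁻¹ᴬ : Automorphism → Automorphism
  φ ⁻¹ᴬ = record
    { φᵥ = flipₚ (φᵥ φ)
    ; φₑ = flipₚ (φₑ φ)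
    ; source-commutes = inv-commutes (φᵥ φ) (φₑ φ) source (source-commutes φ)
    ; target-commutes = inv-commutes (φᵥ φ) (φₑ φ) target (target-commutes φ)
    }

  Aut : Group 0ℓ 0ℓ
  Aut = record
    { Carrier = Automorphism
    ; _≈_     = _≈ᴬ_
    ; _∙_     = _∘ᴬ_
    ; ε       = idᴬ
    ; _⁻¹     = _⁻¹ᴬ
    ; isGroup = record
      { isMonoid = record
        { isSemigroup = record
          { isMagma = record
            { isEquivalence = record
              { refl  = (λ _ → refl) , (λ _ → refl)
              ; sym   = λ (p , q) → (λ i → sym (p i)) , (λ i → sym (q i))
              ; trans = λ (p , q) (r , s) →
                  (λ i → trans (p i) (r i)) , (λ i → trans (q i) (s i))
              }
            ; ∙-cong = λ {φ} {φ′} {ψ} {ψ′} (p , q) (r , s) →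
                (λ i → trans (p (φᵥ ψ ⟨$⟩ʳ i)) (cong (φᵥ φ′ ⟨$⟩ʳ_) (r i))) ,
                (λ i → trans (q (φₑ ψ ⟨$⟩ʳ i)) (cong (φₑ φ′ ⟨$⟩ʳ_) (s i)))
            }
          ; assoc = λ _ _ _ → (λ _ → refl) , (λ _ → refl)
          }
        ; identity = (λ _ → (λ _ → refl) , (λ _ → refl))
                   , (λ _ → (λ _ → refl) , (λ _ → refl))
        }
      ; inverse = (λ φ → (λ _ → inverseˡ (φᵥ φ)) , (λ _ → inverseˡ (φₑ φ)))
                , (λ φ → (λ _ → inverseʳ (φᵥ φ)) , (λ _ → inverseʳ (φₑ φ)))
      ; ⁻¹-cong = λ {φ} {ψ} (p , q) →
          ⟨$⟩ˡ-cong (φᵥ φ) (φᵥ ψ) p , ⟨$⟩ˡ-cong (φₑ φ) (φₑ ψ) q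
      }
    }

HasOrder : Group a ℓ → ℕ → Set _
HasOrder G n = HasCardinality (Group.setoid G) n

------------------------------------------------------------------------
-- Automata

-- A deterministic complete automaton with state set Fin n and alphabet Fin k.
record Automaton (n k : ℕ) : Set where
  field
    δ : Fin n → Fin k → Fin n

  δ* : Fin n → List (Fin k) → Fin n
  δ* = foldl δ

  -- V · w, where V is the set of all states.
  V·_ : List (Fin k) → Subset n
  V· w = tabulate λ q → does (any? λ v → δ* v w ≟ q)

  Synchronizing : Set
  Synchronizing = ∃[ w ] ∣ V· w ∣ ≡ 1

------------------------------------------------------------------------
-- Colorings

module _ (G : Graph) where
  open Graph G

  record Coloring (k : ℕ) : Set where
    field
      χ         : E → Fin k
      bijective : ∀ v → Bijective _≡_ _≡_ (λ (e : Out v) → χ (proj₁ e))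

    edge : (v : V) → Fin k → Out v
    edge v a = proj₁ (proj₂ (bijective v) a)

    automaton : Automaton #V k
    automaton = record { δ = λ v a → target (proj₁ (edge v a)) }

  TotallySynchronizing : ℕ → Set
  TotallySynchronizing k =
    (c : Coloring k) → Automaton.Synchronizing (Coloring.automaton c)

{-# OPTIONS --safe #-}
module Submission where

-- By Cauchy's theorem Aut(G) contains an element φ of order p. If φ fixes a
-- vertex v, it permutes the k < p edges leaving v in cycles of length 1 or p,
-- so it fixes them all, and their targets; by strong connectedness φ is the
-- identity. Hence φ acts freely on V, and colouring the edges out of one vertex
-- of each orbit arbitrarily and transporting along φ gives a φ-invariant
-- colouring. φ then commutes with the transition function, so V · w is
-- φ-invariant for every word w and cannot be a singleton.
--
-- Cauchy's theorem is McKay's argument: rotation acts with period p on the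
-- N ^ (p - 1) tuples of length p with product ε, and its fixed points are the
-- constant tuples, i.e. the solutions of g ^ p = ε.

open import Defs
open import Data.Nat.Base using (ℕ; _<_)
open import Data.Nat.Divisibility using (_∣_)
open import Data.Nat.Primality using (Prime)
open import Relation.Nullary.Negation using (¬_)
open import Algebra.Bundles using (Group; RawGroup)
import Algebra.Definitions.RawMonoid
open import Algebra.Morphism.GroupMonomorphism using (isGroup)
open import Algebra.Morphism.Structures using (IsGroupMonomorphism)
open import Algebra.Structures using (IsGroup)
open import Axiom.UniquenessOfIdentityProofs.WithK using (uip)
open import Data.Fin.Base using (Fin; toℕ)
open import Data.Fin.Permutation
  using (Permutation′; _⟨$⟩ʳ_; _⟨$⟩ˡ_; inverseˡ; inverseʳ)
open import Data.Fin.Properties using (_≟_; any?; pigeonhole; toℕ-injective; toℕ<n)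
open import Data.Fin.Subset using (Subset; ∣_∣; Nonempty) renaming (_∈_ to _∈ˢ_)
open import Data.Fin.Subset.Properties
  using (Empty-unique; nonempty?; ∣⊥∣≡0; x∈p∧x≢y⇒x∈p-y; x∈p⇒∣p-x∣<∣p∣)
open import Data.List.Base
  using (List; []; _∷_; [_]; _++_; _∷ʳ_; applyUpTo; upTo; allFin; cartesianProductWith;
         filter; foldr; length; map; replicate)
open import Data.List.Extrema.Nat using (argmin; f[argmin]≤f[xs])
open import Data.List.Membership.DecPropositional using (_∈?_)
open import Data.List.Membership.Propositional using (_∈_; _∉_)
open import Data.List.Membership.Propositional.Properties
  using (∈-allFin; ∈-applyUpTo⁺; ∈-applyUpTo⁻; ∈-cartesianProductWith⁺;
         ∈-cartesianProductWith⁻; ∈-filter⁺; ∈-filter⁻; ∈-map⁺; ∈-map⁻; ∈-++⁺ˡ; ∈-++⁺ʳ;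
         ∈-++⁻; ∈-upTo⁺)
open import Data.List.Membership.Propositional.Properties.WithK using (unique∧set⇒bag)
open import Data.List.Properties
  using (++-assoc; ++-identityʳ; length-++; length-++-comm; length-applyUpTo;
         length-map; length-replicate; length-tabulate; ∷-injective; ≡-dec)
open import Data.List.Relation.Binary.BagAndSetEquality using (∼bag⇒↭)
open import Data.List.Relation.Binary.Permutation.Propositional.Properties
  using (↭-length)
open import Data.List.Relation.Unary.All using ([]; tabulate; lookup)
open import Data.List.Relation.Unary.Any using (here; there)
open import Data.List.Relation.Unary.Unique.Propositional using (Unique; []; _∷_)
import Data.List.Relation.Unary.Unique.Propositional.Properties as Unique
open import Data.Nat.Base
  using (zero; suc; _+_; _*_; _∸_; _^_; _≤_; NonZero; >-nonZero; >-nonZero⁻¹; s≤s; z≤n)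
open import Data.Nat.Coprimality using (Coprime; coprime-Bézout)
open import Data.Nat.DivMod using (_%_; _/_; m≡m%n+[m/n]*n; m%n<n)
open import Data.Nat.Divisibility
  using (divides; _∣?_; _∣0; ∣-refl; ∣m∣n⇒∣m+n; ∣m+n∣m⇒∣n; ∣1⇒≡1; ∣-trans; m∣m*n; ∣⇒≤)
open import Data.Nat.GCD using (module Bézout)
open import Data.Nat.GeneralisedArithmetic
  using (fold; fold-+; iterate; iterate-is-fold)
open import Data.Nat.Induction using (<-wellFounded)
open import Data.Nat.Primality
  using (prime⇒irreducible; prime⇒nonZero; ¬prime[0]; ¬prime[1])
open import Data.Nat.Properties
  using (+-comm; +-assoc; ≤-trans; ≤-total; <⇒≤; m∸n+n≡m; m≤m*n; m∸n≤m; m<n⇒0<n∸m;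
         ≤-<-trans; <⇒≱; m<n+m; m≤n⇒m<n∨m≡n; ≤-antisym; >⇒≢; m+[n∸m]≡n;
         module ≤-Reasoning)
open import Data.Product.Base using (∃-syntax; _,_; proj₁; proj₂; _×_; uncurry)
open import Data.Sum.Base using (inj₁; inj₂; [_,_]′)
open import Data.Vec.Properties using (lookup∘tabulate; lookup⇒[]=; []=⇒lookup)
open import Function.Base using (_∘_)
open import Function.Bundles using (Inverse; mk⇔; Bijection)
open import Function.Definitions using (Bijective)
open import Function.Properties.Bijection using (Bijection⇒Inverse)
open import Induction.WellFounded using (Acc; acc)
open import Relation.Binary.Construct.Closure.ReflexiveTransitive using (Star; ε; _◅_)
open import Relation.Binary.Definitions using (DecidableEquality)
open import Relation.Binary.PropositionalEquality
  using (_≡_; _≢_; refl; sym; trans; cong; cong₂; subst; module ≡-Reasoning)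
open import Relation.Nullary.Decidable using (yes; no; ¬?; _×-dec_; dec-true)
open import Relation.Nullary.Negation using (contradiction)

module Mult {a ℓ} (G : Group a ℓ) = Algebra.Definitions.RawMonoid (Group.rawMonoid G)

prime⇒≥1 : ∀ {p} → Prime p → 1 ≤ p
prime⇒≥1 pr = >-nonZero⁻¹ _ {{prime⇒nonZero pr}}

-- Iterates of a self-map and their periods.

module _ {a} {A : Set a} {s : A → A} where

  fold-periodic-* : ∀ {x p} → fold x s p ≡ x → ∀ m → fold x s (m * p) ≡ x
  fold-periodic-* eq zero = refl
  fold-periodic-* {x} {p} eq (suc m) =
    trans (fold-+ x s p) (trans (cong (λ y → fold y s p) (fold-periodic-* eq m)) eq)

  fold-fixed : ∀ {x} → s x ≡ x → ∀ n → fold x s n ≡ x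
  fold-fixed eq zero    = refl
  fold-fixed eq (suc n) = trans (cong s (fold-fixed eq n)) eq

  fold-injective : (∀ {x y} → s x ≡ s y → x ≡ y) →
                   ∀ n {x y} → fold x s n ≡ fold y s n → x ≡ y
  fold-injective inj zero    eq = eq
  fold-injective inj (suc n) eq = fold-injective inj n (inj eq)

  fold-surjective : (∀ y → ∃[ x ] s x ≡ y) → ∀ n y → ∃[ x ] fold x s n ≡ y
  fold-surjective sur zero    y = y , refl
  fold-surjective sur (suc n) y with z , refl ← sur y with x , refl ← fold-surjective sur n z =
    x , refl

  -- On a point of period `p`, the power of `s` with exponent `p ∸ 1` undoes `s`; this stands in for
  -- an inverse of `s`.
  fold-period-pred : ∀ {x p} → 1 ≤ p → fold x s p ≡ x → fold (s x) s (p ∸ 1) ≡ x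
  fold-period-pred {x} {p} 1≤p per =
    trans (sym (fold-+ x s (p ∸ 1))) (trans (cong (fold x s) (m∸n+n≡m 1≤p)) per)

  -- By Bézout, some multiple of one period exceeds a multiple of the other by exactly 1; the extra
  -- application of `s` then does nothing. The two cases say which multiple is larger.
  coprime-periods⇒fixed : ∀ {x m n} → Coprime m n →
                          fold x s m ≡ x → fold x s n ≡ x → s x ≡ x
  coprime-periods⇒fixed {x} {m} {n} c pm pn with coprime-Bézout c
  ... | Bézout.+- i j eq = begin
    s x                  ≡⟨ cong s (fold-periodic-* pn j) ⟨
    fold x s (1 + j * n) ≡⟨ cong (fold x s) eq ⟩
    fold x s (i * m)     ≡⟨ fold-periodic-* pm i ⟩
    x                    ∎ where open ≡-Reasoning
  ... | Bézout.-+ i j eq = begin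
    s x                  ≡⟨ cong s (fold-periodic-* pm i) ⟨
    fold x s (1 + i * m) ≡⟨ cong (fold x s) eq ⟩
    fold x s (j * n)     ≡⟨ fold-periodic-* pn j ⟩
    x                    ∎ where open ≡-Reasoning

  module _ {p} (pr : Prime p) {x} (per : fold x s p ≡ x) where

    unfixed⇒prime∣period : s x ≢ x → ∀ {d} → fold x s d ≡ x → p ∣ d
    unfixed⇒prime∣period sx≢x {d} perd with p ∣? d
    ... | yes p∣d = p∣d
    ... | no  p∤d = contradiction (coprime-periods⇒fixed coprime per perd) sx≢x
      where
      coprime : Coprime p d
      coprime (e∣p , e∣d) with prime⇒irreducible pr e∣p
      ... | inj₁ e≡1  = e≡1
      ... | inj₂ refl = contradiction e∣d p∤d

    -- Cancels `i` steps without injectivity of `s`: running both sides forward by `i * p ∸ i`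
    -- further steps completes `i * p`, a multiple of the period.
    fold-collision⇒period : ∀ i d → fold x s (d + i) ≡ fold x s i → fold x s d ≡ x
    fold-collision⇒period i d eq = begin
      fold x s d                            ≡⟨ cong (λ y → fold y s d) (fold-periodic-* per i) ⟨
      fold (fold x s (i * p)) s d           ≡⟨ fold-+ x s d ⟨
      fold x s (d + i * p)                  ≡⟨ cong (fold x s) d+ip≡ ⟩
      fold x s ((i * p ∸ i) + (d + i))      ≡⟨ fold-+ x s (i * p ∸ i) ⟩
      fold (fold x s (d + i)) s (i * p ∸ i) ≡⟨ cong (λ y → fold y s (i * p ∸ i)) eq ⟩
      fold (fold x s i) s (i * p ∸ i)       ≡⟨ fold-+ x s (i * p ∸ i) ⟨
      fold x s (i * p ∸ i + i)              ≡⟨ cong (fold x s) (m∸n+n≡m i≤ip) ⟩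
      fold x s (i * p)                      ≡⟨ fold-periodic-* per i ⟩
      x                                     ∎
      where
      open ≡-Reasoning
      instance _ = prime⇒nonZero pr
      i≤ip : i ≤ i * p
      i≤ip = m≤m*n i p
      d+ip≡ : d + i * p ≡ (i * p ∸ i) + (d + i)
      d+ip≡ = begin
        d + i * p              ≡⟨ cong (d +_) (m∸n+n≡m i≤ip) ⟨
        d + (i * p ∸ i + i)    ≡⟨ +-assoc d _ i ⟨
        (d + (i * p ∸ i)) + i  ≡⟨ cong (_+ i) (+-comm d _) ⟩
        (i * p ∸ i + d) + i    ≡⟨ +-assoc _ d i ⟩
        (i * p ∸ i) + (d + i)  ∎

    -- A coincidence would make `j ∸ i` a period, hence a multiple of `p`, although it lies strictly
    -- between 0 and `p`.
    fold-≢ : s x ≢ x → ∀ {i j} → i < j → j < p → fold x s i ≢ fold x s j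
    fold-≢ sx≢x {i} {j} i<j j<p eq =
      <⇒≱ (≤-<-trans (m∸n≤m j i) j<p) (∣⇒≤ {{j∸i≢0}} (unfixed⇒prime∣period sx≢x perd))
      where
      j∸i≢0 : NonZero (j ∸ i)
      j∸i≢0 = >-nonZero (m<n⇒0<n∸m i<j)
      perd : fold x s (j ∸ i) ≡ x
      perd = fold-collision⇒period i (j ∸ i) (trans (cong (fold x s) (m∸n+n≡m (<⇒≤ i<j))) (sym eq))

fold-% : ∀ {a} {A : Set a} {s : A → A} {x p} .{{_ : NonZero p}} → fold x s p ≡ x →
         ∀ n → fold x s n ≡ fold x s (n % p)
fold-% {s = s} {x} {p} per n = begin
  fold x s n                              ≡⟨ cong (fold x s) (m≡m%n+[m/n]*n n p) ⟩
  fold x s (n % p + (n / p) * p)          ≡⟨ fold-+ x s (n % p) ⟩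
  fold (fold x s ((n / p) * p)) s (n % p)
    ≡⟨ cong (λ y → fold y s (n % p)) (fold-periodic-* per (n / p)) ⟩
  fold x s (n % p)                        ∎
  where open ≡-Reasoning

-- Exponents that agree at a point not fixed by s are congruent modulo p.
fold-≡-transfer : ∀ {a b} {A : Set a} {B : Set b} {s : A → A} {t : B → B} {p} → Prime p →
                  ∀ {x y} → fold x s p ≡ x → s x ≢ x → fold y t p ≡ y →
                  ∀ m n → fold x s m ≡ fold x s n → fold y t m ≡ fold y t n
fold-≡-transfer {s = s} {t} {p} pr {x} {y} perx sx≢x pery m n eq =
  [ (λ m≤n → sym (ordered m≤n (sym eq))) , (λ n≤m → ordered n≤m eq) ]′ (≤-total m n)
  where
  ordered : ∀ {m n} → m ≤ n → fold x s n ≡ fold x s m → fold y t n ≡ fold y t m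
  ordered {m} {n} m≤n eq = begin
    fold y t n                  ≡⟨ cong (fold y t) (m+[n∸m]≡n m≤n) ⟨
    fold y t (m + (n ∸ m))      ≡⟨ fold-+ y t m ⟩
    fold (fold y t (n ∸ m)) t m ≡⟨ cong (λ z → fold z t m) pery∸ ⟩
    fold y t m                  ∎
    where
    open ≡-Reasoning
    perx∸ : fold x s (n ∸ m) ≡ x
    perx∸ = fold-collision⇒period pr perx m (n ∸ m) (trans (cong (fold x s) (m∸n+n≡m m≤n)) eq)
    pery∸ : fold y t (n ∸ m) ≡ y
    -- Divisibility of `n ∸ m` by `p` is what passes from `x` to `y`.
    pery∸ with divides q n∸m≡ ← unfixed⇒prime∣period pr perx sx≢x {n ∸ m} perx∸ =
      trans (cong (fold y t) n∸m≡) (fold-periodic-* pery q)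

-- A cyclic action of prime order

module _ {a} {A : Set a} (_≟ᴬ_ : DecidableEquality A) (s : A → A) {p} (pr : Prime p) where

  private
    Periodic : List A → Set a
    Periodic xs = ∀ {x} → x ∈ xs → fold x s p ≡ x

    Closed : List A → Set a
    Closed xs = ∀ {x} → x ∈ xs → s x ∈ xs

    orbit : A → List A
    orbit x = applyUpTo (fold x s) p

    fold-∈ : ∀ {xs} → Closed xs → ∀ {x} → x ∈ xs → ∀ n → fold x s n ∈ xs
    fold-∈ closed x∈ zero    = x∈
    fold-∈ closed x∈ (suc n) = closed (fold-∈ closed x∈ n)

    module _ {x} (perx : fold x s p ≡ x) where

      orbit-closed : Closed (orbit x)
      orbit-closed y∈
        with i , i<p , refl ← ∈-applyUpTo⁻ (fold x s) y∈
        with m≤n⇒m<n∨m≡n i<p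
      ... | inj₁ 1+i<p = ∈-applyUpTo⁺ (fold x s) 1+i<p
      -- The last orbit entry wraps around to the entry with exponent 0.
      ... | inj₂ refl  = subst (_∈ orbit x) (sym perx) (∈-applyUpTo⁺ (fold x s) (prime⇒≥1 pr))

      -- Orbits are closed backwards too, since `p ∸ 1` more steps lead from `s y` to `y`. Hence
      -- removing an orbit leaves a closed list.
      ∈-orbit⁻ : ∀ {y} → fold y s p ≡ y → s y ∈ orbit x → y ∈ orbit x
      ∈-orbit⁻ pery sy∈ =
        subst (_∈ orbit x) (fold-period-pred (prime⇒≥1 pr) pery) (fold-∈ orbit-closed sy∈ (p ∸ 1))

  -- The orbit of the head has exactly `p` distinct entries; remove it and recurse on the rest. The
  -- rest is not a sublist visible to the termination checker, hence the `Acc` on the length.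
  unfixed⇒prime∣length : ∀ xs → Acc _<_ (length xs) → Unique xs → Closed xs → Periodic xs →
                         (∀ {x} → x ∈ xs → s x ≢ x) → p ∣ length xs
  unfixed⇒prime∣length [] _ _ _ _ _ = p ∣0
  unfixed⇒prime∣length xs@(x ∷ _) (acc rec) uniq closed per unfixed =
    subst (p ∣_) (sym length-xs) (∣m∣n⇒∣m+n ∣-refl
      (unfixed⇒prime∣length rest (rec rest<xs) (Unique.filter⁺ ∉orbit? uniq)
        rest-closed (per ∘ proj₁ ∘ rest⁻) (unfixed ∘ proj₁ ∘ rest⁻)))
    where
    ∉orbit? = λ y → ¬? (_∈?_ _≟ᴬ_ y (orbit x))
    rest = filter ∉orbit? xs

    rest⁻ : ∀ {y} → y ∈ rest → y ∈ xs × y ∉ orbit x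
    rest⁻ = ∈-filter⁻ ∉orbit? {xs = xs}

    orbit⊆xs : ∀ {y} → y ∈ orbit x → y ∈ xs
    orbit⊆xs y∈ with i , _ , refl ← ∈-applyUpTo⁻ (fold x s) y∈ = fold-∈ closed (here refl) i

    rest-closed : Closed rest
    rest-closed y∈ with y∈xs , y∉ ← rest⁻ y∈ =
      ∈-filter⁺ ∉orbit? (closed y∈xs) (y∉ ∘ ∈-orbit⁻ (per (here refl)) (per y∈xs))

    to : ∀ {y} → y ∈ xs → y ∈ orbit x ++ rest
    to {y} y∈ with _∈?_ _≟ᴬ_ y (orbit x)
    ... | yes y∈o = ∈-++⁺ˡ y∈o
    ... | no  y∉o = ∈-++⁺ʳ (orbit x) (∈-filter⁺ ∉orbit? y∈ y∉o)

    from : ∀ {y} → y ∈ orbit x ++ rest → y ∈ xs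
    from y∈ with ∈-++⁻ (orbit x) y∈
    ... | inj₁ y∈o = orbit⊆xs y∈o
    ... | inj₂ y∈r = proj₁ (rest⁻ y∈r)

    length-xs : length xs ≡ p + length rest
    length-xs = begin
      -- Duplicate-free lists with the same members are permutations of each other.
      length xs                      ≡⟨ ↭-length (∼bag⇒↭ (unique∧set⇒bag uniq uniq′ (mk⇔ to from))) ⟩
      length (orbit x ++ rest)       ≡⟨ length-++ (orbit x) ⟩
      length (orbit x) + length rest ≡⟨ cong (_+ length rest) (length-applyUpTo (fold x s) p) ⟩
      p + length rest                ∎
      where
      open ≡-Reasoning
      uniq′ : Unique (orbit x ++ rest)
      uniq′ = Unique.++⁺
        (Unique.applyUpTo⁺₁ (fold x s) p (fold-≢ pr (per (here refl)) (unfixed (here refl))))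
        (Unique.filter⁺ ∉orbit? uniq)
        (λ (y∈o , y∈r) → proj₂ (rest⁻ y∈r) y∈o)

    rest<xs : length rest < length xs
    rest<xs = subst (length rest <_) (sym length-xs) (m<n+m _ (prime⇒≥1 pr))

  -- The moved entries are a multiple of `p` in number, and `e` is the only other entry, so the
  -- length is 1 modulo `p`.
  unique-fixed⇒¬prime∣length : ∀ {xs} → Unique xs → Closed xs → Periodic xs →
                               ∀ {e} → e ∈ xs → s e ≡ e →
                               (∀ {x} → x ∈ xs → s x ≡ x → x ≡ e) → ¬ p ∣ length xs
  unique-fixed⇒¬prime∣length {xs} uniq closed per {e} e∈ se≡e only p∣ =
    ¬prime[1] (subst Prime (∣1⇒≡1 p∣1) pr)
    where
    unfixed? = λ x → ¬? (s x ≟ᴬ x)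
    moved = filter unfixed? xs

    moved⁻ : ∀ {y} → y ∈ moved → y ∈ xs × s y ≢ y
    moved⁻ = ∈-filter⁻ unfixed? {xs = xs}

    p∣moved : p ∣ length moved
    p∣moved = unfixed⇒prime∣length moved (<-wellFounded _) (Unique.filter⁺ unfixed? uniq)
      (λ y∈ → let y∈xs , sy≢y = moved⁻ y∈ in
        ∈-filter⁺ unfixed? (closed y∈xs)
          (λ ssy≡sy → sy≢y (fold-collision⇒period pr (per y∈xs) 1 1 ssy≡sy)))
      (per ∘ proj₁ ∘ moved⁻) (proj₂ ∘ moved⁻)

    to : ∀ {y} → y ∈ xs → y ∈ e ∷ moved
    to {y} y∈ with s y ≟ᴬ y
    ... | yes sy≡y = here (only y∈ sy≡y)
    ... | no  sy≢y = there (∈-filter⁺ unfixed? y∈ sy≢y)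

    from : ∀ {y} → y ∈ e ∷ moved → y ∈ xs
    from (here refl) = e∈
    from (there y∈)  = proj₁ (moved⁻ y∈)

    uniq′ : Unique (e ∷ moved)
    uniq′ = tabulate (λ { y∈ refl → proj₂ (moved⁻ y∈) se≡e }) ∷ Unique.filter⁺ unfixed? uniq

    length-xs : length xs ≡ length moved + 1
    length-xs = trans (↭-length (∼bag⇒↭ (unique∧set⇒bag uniq uniq′ (mk⇔ to from)))) (+-comm 1 _)

    p∣1 : p ∣ 1
    p∣1 = ∣m+n∣m⇒∣n (subst (p ∣_) length-xs p∣) p∣moved

-- Rotation of lists.

module _ {a} {A : Set a} where

  rotate : List A → List A
  rotate []       = []
  rotate (x ∷ xs) = xs ∷ʳ x

  length-rotate : ∀ xs → length (rotate xs) ≡ length xs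
  length-rotate []       = refl
  length-rotate (x ∷ xs) = length-++-comm xs [ x ]

  -- Splitting the list makes the induction work: each rotation moves the head of `xs` behind `ys`.
  -- `iterate` rotates first and then recurses, which matches induction on `xs`.
  iterate-rotate-++ : ∀ xs ys → iterate rotate (xs ++ ys) (length xs) ≡ ys ++ xs
  iterate-rotate-++ []       ys = sym (++-identityʳ ys)
  iterate-rotate-++ (x ∷ xs) ys = begin
    iterate rotate ((xs ++ ys) ∷ʳ x) (length xs)
      ≡⟨ cong (λ zs → iterate rotate zs (length xs)) (++-assoc xs ys [ x ]) ⟩
    iterate rotate (xs ++ (ys ∷ʳ x)) (length xs)
      ≡⟨ iterate-rotate-++ xs (ys ∷ʳ x) ⟩
    (ys ∷ʳ x) ++ xs
      ≡⟨ ++-assoc ys [ x ] xs ⟩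
    ys ++ x ∷ xs ∎
    where open ≡-Reasoning

  fold-rotate-length : ∀ xs → fold xs rotate (length xs) ≡ xs
  fold-rotate-length xs = begin
    fold xs rotate (length xs)
      ≡⟨ iterate-is-fold xs rotate (length xs) ⟩
    iterate rotate xs (length xs)
      ≡⟨ cong (λ ys → iterate rotate ys (length xs)) (++-identityʳ xs) ⟨
    iterate rotate (xs ++ []) (length xs)
      ≡⟨ iterate-rotate-++ xs [] ⟩
    xs ∎
    where open ≡-Reasoning

  -- The hypothesis says that rotation fixes `x ∷ xs`. Heads give `y ≡ x`, and tails give the same
  -- equation for the shorter list.
  ∷ʳ≡∷⇒replicate : ∀ {x : A} xs → xs ∷ʳ x ≡ x ∷ xs → xs ≡ replicate (length xs) x
  ∷ʳ≡∷⇒replicate []       eq = refl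
  ∷ʳ≡∷⇒replicate (y ∷ ys) eq with refl , eq′ ← ∷-injective eq = cong (y ∷_) (∷ʳ≡∷⇒replicate ys eq′)

  replicate-∷ʳ : ∀ n (x : A) → replicate n x ∷ʳ x ≡ x ∷ replicate n x
  replicate-∷ʳ zero    x = refl
  replicate-∷ʳ (suc n) x = cong (x ∷_) (replicate-∷ʳ n x)

-- Enumeration of the words of given length.

words : ∀ N → ℕ → List (List (Fin N))
words N zero    = [ [] ]
words N (suc m) = cartesianProductWith _∷_ (allFin N) (words N m)

length-cartesianProductWith : ∀ {a b c} {A : Set a} {B : Set b} {C : Set c} (f : A → B → C) xs ys →
                              length (cartesianProductWith f xs ys) ≡ length xs * length ys
length-cartesianProductWith f []       ys = refl
length-cartesianProductWith f (x ∷ xs) ys =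
  trans (length-++ (map (f x) ys))
        (cong₂ _+_ (length-map (f x) ys) (length-cartesianProductWith f xs ys))

length-words : ∀ N m → length (words N m) ≡ N ^ m
length-words N zero    = refl
length-words N (suc m) =
  trans (length-cartesianProductWith _∷_ (allFin N) (words N m))
        (cong₂ _*_ (length-tabulate {n = N} (λ i → i)) (length-words N m))

words-unique : ∀ N m → Unique (words N m)
words-unique N zero    = [] ∷ []
words-unique N (suc m) =
  Unique.cartesianProductWith⁺ _∷_ ∷-injective (Unique.allFin⁺ N) (words-unique N m)

∈-words⁺ : ∀ {N} xs → xs ∈ words N (length xs)
∈-words⁺ []       = here refl
∈-words⁺ (x ∷ xs) = ∈-cartesianProductWith⁺ _∷_ (∈-allFin x) (∈-words⁺ xs)

∈-words⁻ : ∀ {N} m {xs} → xs ∈ words N m → length xs ≡ m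
∈-words⁻ zero    (here refl) = refl
∈-words⁻ (suc m) xs∈
  with _ , _ , _ , ys∈ , refl ← ∈-cartesianProductWith⁻ _∷_ (allFin _) (words _ m) xs∈ =
  cong suc (∈-words⁻ m ys∈)

-- Cauchy's theorem

module _ {N : ℕ} {_∙_ : Fin N → Fin N → Fin N} {ε : Fin N} {_⁻¹ : Fin N → Fin N}
         (isGrp : IsGroup _≡_ _∙_ ε _⁻¹) where

  private
    𝔽 : Group _ _
    𝔽 = record { isGroup = isGrp }

  open Group 𝔽 using (assoc; identityˡ; identityʳ) renaming (inverseˡ to ⁻¹-inverseˡ)
  open import Algebra.Properties.Group 𝔽 using (inverseˡ-unique; inverseʳ-unique)
  open Mult 𝔽 using () renaming (_×_ to _×ᴳ_)

  product : List (Fin N) → Fin N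
  product = foldr _∙_ ε

  product-∷ʳ : ∀ xs x → product (xs ∷ʳ x) ≡ product xs ∙ x
  product-∷ʳ []       x = trans (identityʳ x) (sym (identityˡ x))
  product-∷ʳ (y ∷ ys) x = trans (cong (y ∙_) (product-∷ʳ ys x)) (sym (assoc y (product ys) x))

  -- If `x ∙ product xs` is `ε`, then `product xs` is the inverse of `x`, so the product in the
  -- other order is `ε` as well.
  product-rotate : ∀ xs → product xs ≡ ε → product (rotate xs) ≡ ε
  product-rotate []       eq = eq
  product-rotate (x ∷ xs) eq =
    trans (product-∷ʳ xs x)
      (trans (cong (_∙ x) (inverseʳ-unique x (product xs) eq)) (⁻¹-inverseˡ x))

  product-replicate : ∀ n x → product (replicate n x) ≡ n ×ᴳ x
  product-replicate zero    x = refl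
  product-replicate (suc n) x = cong (x ∙_) (product-replicate n x)

  ×-ε : ∀ n → n ×ᴳ ε ≡ ε
  ×-ε zero    = refl
  ×-ε (suc n) = trans (identityˡ _) (×-ε n)

  private
    close : List (Fin N) → List (Fin N)
    close xs = (product xs ⁻¹) ∷ xs

  -- The tuples of length m + 1 with product ε: the last m entries are free.
  tuples : ℕ → List (List (Fin N))
  tuples m = map close (words N m)

  ∈-tuples⁻ : ∀ m {xs} → xs ∈ tuples m → length xs ≡ suc m × product xs ≡ ε
  ∈-tuples⁻ m xs∈ with ws , ws∈ , refl ← ∈-map⁻ close xs∈ =
    cong suc (∈-words⁻ m ws∈) , ⁻¹-inverseˡ (product ws)

  ∈-tuples⁺ : ∀ {m} xs → length xs ≡ suc m → product xs ≡ ε → xs ∈ tuples m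
  ∈-tuples⁺ (x ∷ xs) refl eq =
    subst (λ y → y ∷ xs ∈ tuples (length xs)) (sym (inverseˡ-unique x (product xs) eq))
          (∈-map⁺ close (∈-words⁺ xs))

  length-tuples : ∀ m → length (tuples m) ≡ N ^ m
  length-tuples m = trans (length-map close (words N m)) (length-words N m)

  cauchy-Fin : ∀ {p} → Prime p → p ∣ N → ∃[ g ] (g ≢ ε × p ×ᴳ g ≡ ε)
  cauchy-Fin {zero}        pr _   = contradiction pr ¬prime[0]
  cauchy-Fin {suc zero}    pr _   = contradiction pr ¬prime[1]
  cauchy-Fin {p@(suc m@(suc l))} pr p∣N
    with any? (λ g → ¬? (g ≟ ε) ×-dec ((p ×ᴳ g) ≟ ε))
  ... | yes found = found
  -- Without an element of order `p`, the constant `ε` tuple is the only one fixed by rotation, so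
  -- `p` cannot divide the number of tuples.
  ... | no  none  = contradiction p∣tuples
    (unique-fixed⇒¬prime∣length (≡-dec _≟_) rotate pr
      -- A word is the tail of its tuple, so `close` is injective.
      (Unique.map⁺ (proj₂ ∘ ∷-injective) (words-unique N m))
      (λ {xs} xs∈ → let len , prd = ∈-tuples⁻ m xs∈ in
        ∈-tuples⁺ (rotate xs) (trans (length-rotate xs) len) (product-rotate xs prd))
      (λ {xs} xs∈ →
        subst (λ n → fold xs rotate n ≡ xs) (proj₁ (∈-tuples⁻ m xs∈)) (fold-rotate-length xs))
      (∈-tuples⁺ (replicate p ε) (length-replicate p)
        (trans (product-replicate (suc m) ε) (×-ε p)))
      (replicate-∷ʳ m ε)
      only)
    where
    p∣tuples : p ∣ length (tuples m)
    -- As `m` is `suc l`, the power `N ^ m` has the factor `N`.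
    p∣tuples = subst (p ∣_) (sym (length-tuples m)) (∣-trans p∣N (m∣m*n (N ^ l)))

    only : ∀ {xs} → xs ∈ tuples m → rotate xs ≡ xs → xs ≡ replicate p ε
    only {[]}     xs∈ _  with () ← proj₁ (∈-tuples⁻ m xs∈)
    only {x ∷ xs} xs∈ eq with x ≟ ε
    ... | yes refl = trans (cong (ε ∷_) (∷ʳ≡∷⇒replicate xs eq))
                           (cong (λ n → replicate n ε) (proj₁ (∈-tuples⁻ m xs∈)))
    ... | no  x≢ε  = contradiction (x , x≢ε , xᵖ≡ε) none
      where
      open ≡-Reasoning
      xᵖ≡ε : p ×ᴳ x ≡ ε
      xᵖ≡ε = begin
        p ×ᴳ x
          ≡⟨ product-replicate p x ⟨
        product (replicate p x)
          ≡⟨ cong (product ∘ λ n → replicate n x) {suc (length xs)} {p} (proj₁ (∈-tuples⁻ m xs∈)) ⟨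
        product (x ∷ replicate (length xs) x)
          ≡⟨ cong (product ∘ (x ∷_)) (∷ʳ≡∷⇒replicate xs eq) ⟨
        product (x ∷ xs)
          ≡⟨ proj₂ (∈-tuples⁻ m xs∈) ⟩
        ε ∎

-- Transfer of Cauchy's theorem to groups given by a setoid.

module _ {a ℓ} (G : Group a ℓ) {N} (order : HasOrder G N) where

  private
    module G = Group G
    open Inverse (Bijection⇒Inverse order)
      using (to; from; to-cong; strictlyInverseˡ; strictlyInverseʳ)

    -- Transporting the operations to `Fin N` provides propositional decidable equality and a list
    -- of all elements. The group laws are pulled back along the monomorphism `from`.
    raw : RawGroup _ _
    raw = record
      { Carrier = Fin N
      ; _≈_     = _≡_
      ; _∙_     = λ i j → to (from i G.∙ from j)
      ; ε       = to G.ε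
      ; _⁻¹     = λ i → to (from i G.⁻¹)
      }

    isMonomorphism : IsGroupMonomorphism raw G.rawGroup from
    isMonomorphism = record
      { isGroupHomomorphism = record
        { isMonoidHomomorphism = record
          { isMagmaHomomorphism = record
            { isRelHomomorphism = record { cong = G.reflexive ∘ cong from }
            ; homo = λ _ _ → strictlyInverseʳ _
            }
          ; ε-homo = strictlyInverseʳ _
          }
        ; ⁻¹-homo = λ _ → strictlyInverseʳ _
        }
      ; injective = λ {i} {j} eq →
          trans (sym (strictlyInverseˡ i)) (trans (to-cong eq) (strictlyInverseˡ j))
      }

    isGroup-Fin = isGroup isMonomorphism G.isGroup

    𝔽 : Group _ _
    𝔽 = record { isGroup = isGroup-Fin }

  open Mult G using () renaming (_×_ to _×ᴳ_)

  cauchy : ∀ {p} → Prime p → p ∣ N → ∃[ g ] (¬ g G.≈ G.ε × p ×ᴳ g G.≈ G.ε)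
  cauchy {p} pr p∣N with g , g≢ε , gᵖ≡ε ← cauchy-Fin isGroup-Fin pr p∣N =
    from g ,
    (λ eq → g≢ε (trans (sym (strictlyInverseˡ g)) (to-cong eq))) ,
    G.trans (G.sym (from-× p g)) (G.trans (G.reflexive (cong from gᵖ≡ε)) (strictlyInverseʳ _))
    where
    open Mult 𝔽 using () renaming (_×_ to _×ꟳ_)
    from-× : ∀ n i → from (n ×ꟳ i) G.≈ n ×ᴳ from i
    from-× zero    i = strictlyInverseʳ _
    from-× (suc n) i = G.trans (strictlyInverseʳ _) (G.∙-congˡ (from-× n i))

-- One-element subsets.

∣p∣≡1⇒nonempty : ∀ {n} (S : Subset n) → ∣ S ∣ ≡ 1 → Nonempty S
∣p∣≡1⇒nonempty {n} S eq with nonempty? S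
... | yes ne = ne
... | no  em with () ← trans (sym eq) (trans (cong ∣_∣ (Empty-unique em)) (∣⊥∣≡0 n))

-- Were `x` and `y` distinct, removing first `x` and then `y` would lower the size twice, so it
-- would be at least 2.
∣p∣≡1⇒≡ : ∀ {n} {S : Subset n} → ∣ S ∣ ≡ 1 → ∀ {x y} → x ∈ˢ S → y ∈ˢ S → x ≡ y
∣p∣≡1⇒≡ {S = S} eq {x} {y} x∈ y∈ with x ≟ y
... | yes x≡y = x≡y
... | no  x≢y = contradiction eq (>⇒≢ (≤-trans (s≤s (≤-trans (s≤s z≤n) y∈S-x)) (x∈p⇒∣p-x∣<∣p∣ x∈)))
  where y∈S-x = x∈p⇒∣p-x∣<∣p∣ (x∈p∧x≢y⇒x∈p-y y∈ (x≢y ∘ sym))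

-- Automata with a state map commuting with the transitions.

module _ {n k} (𝒜 : Automaton n k) where
  open Automaton 𝒜

  ∈-V·⁺ : ∀ w v → δ* v w ∈ˢ V· w
  ∈-V·⁺ w v = lookup⇒[]= _ _ (trans (lookup∘tabulate _ (δ* v w))
    (dec-true (any? λ u → δ* u w ≟ δ* v w) (v , refl)))

  ∈-V·⁻ : ∀ w {q} → q ∈ˢ V· w → ∃[ v ] δ* v w ≡ q
  -- Abstracting the decision in the membership equation as well turns the `no` case into an absurd
  -- equation of booleans.
  ∈-V·⁻ w {q} q∈ with any? (λ v → δ* v w ≟ q) | trans (sym (lookup∘tabulate _ q)) ([]=⇒lookup q∈)
  ... | yes found | _ = found

  module _ {σ : Fin n → Fin n} (δ-σ : ∀ v a → δ (σ v) a ≡ σ (δ v a)) where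

    δ*-σ : ∀ v w → δ* (σ v) w ≡ σ (δ* v w)
    δ*-σ v []      = refl
    δ*-σ v (a ∷ w) = trans (cong (λ u → δ* u w) (δ-σ v a)) (δ*-σ (δ v a) w)

    -- The witness is the state `δ* v w` reached by the word; its image under `σ` is reached from
    -- `σ v` by the same word, so the two agree.
    synchronizing⇒fixed-state : Synchronizing → ∃[ q ] σ q ≡ q
    synchronizing⇒fixed-state (w , eq)
      with q , q∈ ← ∣p∣≡1⇒nonempty (V· w) eq
      with v , refl ← ∈-V·⁻ w q∈ =
      q , ∣p∣≡1⇒≡ eq (subst (_∈ˢ V· w) (δ*-σ v w) (∈-V·⁺ w (σ v))) q∈

permutation-injective : ∀ {n} (π : Permutation′ n) {i j} → π ⟨$⟩ʳ i ≡ π ⟨$⟩ʳ j → i ≡ j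
permutation-injective π eq =
  trans (sym (inverseˡ π)) (trans (cong (Inverse.from π) eq) (inverseˡ π))

-- Automorphisms of prime order

module _ (G : Graph) {k : ℕ} (kOut : Graph.IsKOut G k) (φ : Automorphism G) where
  open Graph G
  open Automorphism φ

  private
    module Out v = Bijection (kOut v)

    σ : V → V
    σ = φᵥ ⟨$⟩ʳ_

    τ : E → E
    τ = φₑ ⟨$⟩ʳ_

    Out-≡ : ∀ {v} {e e′ : Out v} → proj₁ e ≡ proj₁ e′ → e ≡ e′
    Out-≡ {e = e , pe} {_ , pe′} refl = cong (e ,_) (uip pe pe′)

    -- A reference numbering of the edges out of each vertex, chosen with no regard to `φ`.
    base : E → Fin k
    base e = Out.to (source e) (e , refl)

    base-injective : ∀ {e e′} → source e ≡ source e′ → base e ≡ base e′ → e ≡ e′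
    base-injective {e} {e′} eq eq′ = lemma eq refl refl eq′
      where
      lemma : ∀ {v v′} → v ≡ v′ → (p : source e ≡ v) (p′ : source e′ ≡ v′) →
              Out.to v (e , p) ≡ Out.to v′ (e′ , p′) → e ≡ e′
      lemma refl p p′ eq = cong proj₁ (Out.injective _ eq)

    base-surjective : ∀ v a → ∃[ e ] (source e ≡ v × base e ≡ a)
    base-surjective v a with (e , refl) , eq ← Out.surjective v a = e , refl , eq refl

  source-fold : ∀ e n → source (fold e τ n) ≡ fold (source e) σ n
  source-fold e zero    = refl
  source-fold e (suc n) = trans (source-commutes _) (cong σ (source-fold e n))

  module _ {p} (pr : Prime p) (φᵖ-V : ∀ v → fold v σ p ≡ v) (φᵖ-E : ∀ e → fold e τ p ≡ e) where

    -- The first `p` iterates of `e` leave the same vertex, so by pigeonhole two share a `base`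
    -- label and coincide; for a moved edge they would be distinct.
    fixed-vertex⇒fixed-edge : k < p → ∀ e → σ (source e) ≡ source e → τ e ≡ e
    fixed-vertex⇒fixed-edge k<p e fixed with τ e ≟ e
    ... | yes τe≡e = τe≡e
    ... | no  τe≢e with i , j , i<j , eq ← pigeonhole k<p (λ i → base (fold e τ (toℕ i))) =
      contradiction (base-injective (trans (src (toℕ i)) (sym (src (toℕ j)))) eq)
                    (fold-≢ pr (φᵖ-E e) τe≢e i<j (toℕ<n j))
      where
      src : ∀ n → source (fold e τ n) ≡ source e
      src n = trans (source-fold e n) (fold-fixed fixed n)

    fixed-vertex⇒fixed-reachable : k < p → ∀ {u v} → σ u ≡ u → Star Arc u v → σ v ≡ v
    fixed-vertex⇒fixed-reachable k<p fixed ε = fixed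
    fixed-vertex⇒fixed-reachable k<p fixed ((e , refl , refl) ◅ path) =
      fixed-vertex⇒fixed-reachable k<p
        (trans (sym (target-commutes e)) (cong target (fixed-vertex⇒fixed-edge k<p e fixed))) path

    fixed-vertex⇒identity : k < p → StronglyConnected → ∀ {u} → σ u ≡ u → _≈ᴬ_ G φ (idᴬ G)
    fixed-vertex⇒identity k<p connected fixed =
      all-fixed , λ e → fixed-vertex⇒fixed-edge k<p e (all-fixed (source e))
      where all-fixed = λ v → fixed-vertex⇒fixed-reachable k<p fixed (connected _ v)

    module _ (free : ∀ v → σ v ≢ v) where

      private
        instance _ = prime⇒nonZero pr

        rank : V → ℕ → ℕ
        rank v i = toℕ (fold v σ i)

        -- An exponent taking v to the least vertex of its orbit.
        exponent : V → ℕ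
        exponent v = argmin (rank v) 0 (upTo p)

      -- The minimum is taken over exponents below `p` only; any other exponent reduces modulo `p`.
      exponent-minimal : ∀ v n → rank v (exponent v) ≤ rank v n
      exponent-minimal v n = subst (λ u → rank v (exponent v) ≤ toℕ u) (sym (fold-% (φᵖ-V v) n))
        (lookup (f[argmin]≤f[xs] {f = rank v} 0 (upTo p)) (∈-upTo⁺ (m%n<n n p)))

      -- Both `v` and `σ v` are sent to the least vertex of their common orbit; the `+ 1` is the
      -- step from `v` to `σ v`.
      exponent-σ : ∀ v → fold v σ (exponent (σ v) + 1) ≡ fold v σ (exponent v)
      exponent-σ v = toℕ-injective (≤-antisym upper (exponent-minimal v (exponent (σ v) + 1)))
        where
        upper : rank v (exponent (σ v) + 1) ≤ rank v (exponent v)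
        upper = begin
          rank v (exponent (σ v) + 1)
            ≡⟨ cong toℕ (fold-+ v σ (exponent (σ v)) {1}) ⟩
          rank (σ v) (exponent (σ v))
            -- The competing exponent first returns from `σ v` to `v` in `p ∸ 1` steps, then follows
            -- the choice made for `v`.
            ≤⟨ exponent-minimal (σ v) (exponent v + (p ∸ 1)) ⟩
          rank (σ v) (exponent v + (p ∸ 1))
            ≡⟨ cong toℕ (fold-+ (σ v) σ (exponent v)) ⟩
          rank (fold (σ v) σ (p ∸ 1)) (exponent v)
            ≡⟨ cong (λ u → rank u (exponent v)) (fold-period-pred (prime⇒≥1 pr) (φᵖ-V v)) ⟩
          rank v (exponent v) ∎
          where open ≤-Reasoning

      -- The least vertex of each orbit serves as its representative: edges elsewhere take their
      -- colour from the translate that leaves it.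
      χ : E → Fin k
      χ e = base (fold e τ (exponent (source e)))

      χ-τ : ∀ e → χ (τ e) ≡ χ e
      χ-τ e = cong base (begin
        fold (τ e) τ (exponent (source (τ e)))
          ≡⟨ cong (fold (τ e) τ ∘ exponent) (source-commutes e) ⟩
        fold (τ e) τ (exponent (σ v))
          ≡⟨ fold-+ e τ (exponent (σ v)) ⟨
        fold e τ (exponent (σ v) + 1)
          -- The exponents agree at `v`, which `σ` moves, so they are congruent modulo `p` and agree
          -- at `e` too.
          ≡⟨ coincide (exponent (σ v) + 1) (exponent v) (exponent-σ v) ⟩
        fold e τ (exponent v) ∎)
        where
        open ≡-Reasoning
        v = source e
        coincide = fold-≡-transfer pr (φᵖ-V v) (free v) (φᵖ-E e)

      -- Edges out of `v` share one exponent, so on them `χ` is a power of `τ`, a bijection onto the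
      -- edges out of another vertex, followed by `base`.
      χ-bijective : ∀ v → Bijective _≡_ _≡_ (λ (e : Out v) → χ (proj₁ e))
      χ-bijective v = injective , surjective
        where
        injective : ∀ {e e′ : Out v} → χ (proj₁ e) ≡ χ (proj₁ e′) → e ≡ e′
        injective {e , pe} {e′ , pe′} eq = Out-≡ (fold-injective (permutation-injective φₑ) n
          (base-injective
            (trans (source-fold e n)
              (trans (cong (λ u → fold u σ n) same) (sym (source-fold e′ n))))
            (trans eq (cong (λ u → base (fold e′ τ (exponent u))) (sym same)))))
          where
          n    = exponent (source e)
          same = trans pe (sym pe′)

        surjective : ∀ a → ∃[ e ] (∀ {z : Out v} → z ≡ e → χ (proj₁ z) ≡ a)
        surjective a
          with e₀ , src , eq ← base-surjective (fold v σ (exponent v)) a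
          with e , refl ← fold-surjective {s = τ} (λ y → φₑ ⟨$⟩ˡ y , inverseʳ φₑ) (exponent v) e₀ =
          (e , pe) , λ { refl → trans (cong (λ u → base (fold e τ (exponent u))) pe) eq }
          where
          pe : source e ≡ v
          -- The pulled-back edge leaves `v` because powers of `σ` are injective.
          pe = fold-injective (permutation-injective φᵥ) (exponent v)
                 (trans (sym (source-fold e (exponent v))) src)

      coloring : Coloring G k
      coloring = record { χ = χ ; bijective = χ-bijective }

      open Coloring coloring using (edge)
      open Automaton (Coloring.automaton coloring) using (δ)

      χ-edge : ∀ v a → χ (proj₁ (edge v a)) ≡ a
      χ-edge v a = proj₂ (proj₂ (χ-bijective v) a) refl

      -- Both `edge (σ v) a` and the `τ`-image of `edge v a` leave `σ v` with colour `a`, so they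
      -- are the same edge.
      δ-σ : ∀ v a → δ (σ v) a ≡ σ (δ v a)
      δ-σ v a = trans (cong (target ∘ proj₁) edge-σ) (target-commutes e)
        where
        e = proj₁ (edge v a)
        τe : Out (σ v)
        τe = τ e , trans (source-commutes e) (cong σ (proj₂ (edge v a)))
        edge-σ : edge (σ v) a ≡ τe
        edge-σ = proj₁ (χ-bijective (σ v))
          (trans (χ-edge (σ v) a) (sym (trans (χ-τ e) (χ-edge v a))))

      ¬totallySynchronizing : ¬ TotallySynchronizing G k
      ¬totallySynchronizing sync =
        uncurry free (synchronizing⇒fixed-state (Coloring.automaton coloring) δ-σ (sync coloring))

-- Powers in the automorphism group as iterates, and the conclusion.

module _ (G : Graph) (φ : Automorphism G) where
  open Automorphism
  open Mult (Aut G) using () renaming (_×_ to _×ᴬ_)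

  ×-φᵥ : ∀ n v → φᵥ (n ×ᴬ φ) ⟨$⟩ʳ v ≡ fold v (φᵥ φ ⟨$⟩ʳ_) n
  ×-φᵥ zero    v = refl
  ×-φᵥ (suc n) v = cong (φᵥ φ ⟨$⟩ʳ_) (×-φᵥ n v)

  ×-φₑ : ∀ n e → φₑ (n ×ᴬ φ) ⟨$⟩ʳ e ≡ fold e (φₑ φ ⟨$⟩ʳ_) n
  ×-φₑ zero    e = refl
  ×-φₑ (suc n) e = cong (φₑ φ ⟨$⟩ʳ_) (×-φₑ n e)

corollary3p11 : (G : Graph) (k : ℕ) →
    Graph.StronglyConnected G →
    Graph.IsKOut G k →
    (N : ℕ) → HasOrder (Aut G) N →
    (p : ℕ) → Prime p → k < p → p ∣ N →
    ¬ TotallySynchronizing G k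
corollary3p11 G k connected kOut N order p pr k<p p∣N
  with φ , φ≉id , φᵖ-V , φᵖ-E ← cauchy (Aut G) order pr p∣N =
  ¬totallySynchronizing G kOut φ pr per-V per-E
    (λ v fixed → φ≉id (fixed-vertex⇒identity G kOut φ pr per-V per-E k<p connected fixed))
  where
  per-V = λ v → trans (sym (×-φᵥ G φ p v)) (φᵖ-V v)
  per-E = λ e → trans (sym (×-φₑ G φ p e)) (φᵖ-E e)
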